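{- Let $P$ be a poset with $n$ elements, and let $I$ be an order ideal of $P$. Then the collection $\mathcal{B}_{P,I}$ of $I$-sets of all linear extensions of $P$ is a shifted family of subsets of $[n]=\{1,\dots,n\}$.
   Context: An order ideal of $P$ is a subset $I\subseteq P$ such that $x<_P y$ and $y\in I$ imply $x\in I$. A linear extension of $P$ is a bijection $f:P\to[n]$ such that $i<_P j$ implies $f(i)<f(j)$. The $I$-set of a linear extension $f$ is the set $\{f(i): i\in I\}$. A family $\mathcal{B}$ of subsets of $[n]$ is shifted if for every $B\in\mathcal{B}$ and every pair $a<b$ in $[n]$ with $a\notin B$ and $b\in B$, the set $(B\setminus\{b\})\cup\{a\}$ also belongs to $\mathcal{B}$. -}

module Defs where

open import Data.Fin.Base using (Fin; _<_)
open import Data.Fin.Subset using (Subset; _∈_; _∉_; _∪_; _-_; ⁅_⁆)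
open import Data.Nat.Base using (ℕ)
open import Data.Product.Base using (Σ; ∃; _×_)
open import Function.Bundles using (Bijection; _⇔_)
open import Level using (Level; _⊔_)
open import Relation.Binary.Bundles using (Poset)
open import Relation.Binary.Definitions using (_Respects_)
open import Relation.Binary.PropositionalEquality using (_≡_; setoid)
open import Relation.Unary using (Pred)
import Relation.Binary.Properties.Poset as PosetProperties

private
  variable
    c ℓ₁ ℓ₂ ℓ : Level

-- Throughout, Fin n = {0,…,n-1} with its usual order stands for [n] = {1,…,n}.

-- The elements of a poset are counted up to its equality _≈_.
HasSize : Poset c ℓ₁ ℓ₂ → ℕ → Set (c ⊔ ℓ₁)
HasSize P n = Bijection (Poset.Eq.setoid P) (setoid (Fin n))

module _ (P : Poset c ℓ₁ ℓ₂) where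

  open Poset P using (Carrier; _≈_; module Eq)
  open PosetProperties P using () renaming (_<_ to _<ₚ_)

  -- The field respects-≈ says that I is a subset of the carrier setoid;
  -- I is not assumed decidable.
  record IsOrderIdeal (I : Pred Carrier ℓ) : Set (c ⊔ ℓ₁ ⊔ ℓ₂ ⊔ ℓ) where
    field
      respects-≈ : I Respects _≈_
      downClosed : ∀ {x y} → x <ₚ y → I y → I x

  record LinearExtension (n : ℕ) : Set (c ⊔ ℓ₁ ⊔ ℓ₂) where
    field
      bijection : Bijection Eq.setoid (setoid (Fin n))

    open Bijection bijection public using (to)

    field
      monotone : ∀ {x y} → x <ₚ y → to x < to y

  IsISetOf : ∀ {n} → Pred Carrier ℓ → LinearExtension n → Subset n → Set (c ⊔ ℓ)
  IsISetOf I f B = ∀ k → k ∈ B ⇔ (∃ λ x → I x × LinearExtension.to f x ≡ k)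

  ISets : ∀ n → Pred Carrier ℓ → Pred (Subset n) (c ⊔ ℓ₁ ⊔ ℓ₂ ⊔ ℓ)
  ISets n I B = Σ (LinearExtension n) λ f → IsISetOf I f B

Shifted : ∀ {n} → Pred (Subset n) ℓ → Set ℓ
Shifted 𝓑 = ∀ B → 𝓑 B → ∀ a b → a < b → a ∉ B → b ∈ B → 𝓑 ((B - b) ∪ ⁅ a ⁆)

{-# OPTIONS --safe #-}

-- If a is not in the I-set of f but a+1 is, then f⁻¹(a) ∉ I and f⁻¹(a+1) ∈ I, so f⁻¹(a) is not
-- below f⁻¹(a+1), and exchanging these two values of f gives another linear extension, whose I-set
-- is the adjacent shift. Any shift b → a is a composite of adjacent ones: with c = a+1 strictly
-- between, go b → c and then c → a if c ∉ B, and c → a and then b → c if c ∈ B.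

module Submission where

open import Defs
open import Data.Bool.Base using (true; false)
open import Data.Bool.Properties using (∨-zeroʳ)
open import Data.Fin.Base using (Fin; zero; suc; toℕ; fromℕ<; _<_)
open import Data.Fin.Permutation using (transpose)
import Data.Fin.Permutation.Components as Components
open import Data.Fin.Properties using (_≟_; toℕ<n; toℕ-fromℕ<; ≤∧≢⇒<; <⇒≢)
open import Data.Fin.Subset using (Subset; inside; outside; _∈_; _∉_; _∪_; _-_; ⁅_⁆)
open import Data.Fin.Subset.Properties using (p─⊥≡p; ∪-identityʳ; _∈?_)
open import Data.Nat.Base as ℕ using (ℕ; zero; suc; _+_; _∸_)
import Data.Nat.Properties as ℕ
open import Data.Product.Base using (∃; _×_; _,_)
open import Data.Vec.Base using (_∷_; lookup; _[_]≔_)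
open import Data.Vec.Properties
  using ([]=⇒lookup; lookup⇒[]=; []≔-commutes; []≔-idempotent; []≔-lookup;
         lookup∘update; lookup∘update′)
import Function.Construct.Composition as Composition
open import Function.Bundles using (Bijection; Equivalence; mk⇔)
open import Function.Properties.Inverse using (↔⇒⤖)
open import Level using (Level)
open import Relation.Binary.Bundles using (Poset)
import Relation.Binary.Properties.Poset as PosetProperties
open import Relation.Binary.PropositionalEquality
  using (_≡_; _≢_; refl; sym; ≢-sym; trans; cong; cong₂; subst; module ≡-Reasoning)
open import Relation.Nullary using (¬_; Dec; yes; no; contradiction)
open import Relation.Unary using (Pred)

private
  variable
    c ℓ₁ ℓ₂ ℓ : Level
    n : ℕ

adjacent⇒< : ∀ {a b : Fin n} → toℕ b ≡ suc (toℕ a) → a < b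
adjacent⇒< b≡1+a = ℕ.≤-reflexive (sym b≡1+a)

-- Two successive point updates, so that the commutation and idempotence laws of `_[_]≔_` apply
-- directly. It agrees with `(B - b) ∪ ⁅ a ⁆` for every `B`, whatever the membership of `a` and `b`.
shift : Fin n → Fin n → Subset n → Subset n
shift a b B = (B [ b ]≔ outside) [ a ]≔ inside

p-x≡p[x]≔outside : ∀ (p : Subset n) x → p - x ≡ p [ x ]≔ outside
p-x≡p[x]≔outside (s ∷ p) zero    = cong (outside ∷_) (p─⊥≡p p)
p-x≡p[x]≔outside (s ∷ p) (suc x) = cong (s ∷_) (p-x≡p[x]≔outside p x)

p∪⁅x⁆≡p[x]≔inside : ∀ (p : Subset n) x → p ∪ ⁅ x ⁆ ≡ p [ x ]≔ inside
p∪⁅x⁆≡p[x]≔inside (s ∷ p) zero    = cong₂ _∷_ (∨-zeroʳ s) (∪-identityʳ p)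
p∪⁅x⁆≡p[x]≔inside (true ∷ p)  (suc x) = cong (true ∷_) (p∪⁅x⁆≡p[x]≔inside p x)
p∪⁅x⁆≡p[x]≔inside (false ∷ p) (suc x) = cong (false ∷_) (p∪⁅x⁆≡p[x]≔inside p x)

p-b∪⁅a⁆≡shift : ∀ (B : Subset n) a b → (B - b) ∪ ⁅ a ⁆ ≡ shift a b B
p-b∪⁅a⁆≡shift B a b =
  trans (p∪⁅x⁆≡p[x]≔inside (B - b) a) (cong (_[ a ]≔ inside) (p-x≡p[x]≔outside B b))

∉⇒lookup≡outside : ∀ {B : Subset n} {x} → x ∉ B → lookup B x ≡ outside
∉⇒lookup≡outside {B = B} {x} x∉B with lookup B x in eq
... | true  = contradiction (lookup⇒[]= x B eq) x∉B
... | false = refl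

lookup≡outside⇒∉ : ∀ {B : Subset n} {x} → lookup B x ≡ outside → x ∉ B
lookup≡outside⇒∉ eq x∈B with () ← trans (sym eq) ([]=⇒lookup x∈B)

[]≔-id-local : ∀ (B : Subset n) x {s} → lookup B x ≡ s → B [ x ]≔ s ≡ B
[]≔-id-local B x refl = []≔-lookup B x

-- The first shift fills `c` and the second empties it again, which restores the value that `c` had
-- in `B`.
shift-via-∉ : ∀ {a b c} (B : Subset n) → b ≢ c → c ∉ B →
              shift a c (shift c b B) ≡ shift a b B
shift-via-∉ {a = a} {b} {c} B b≢c c∉B = cong (_[ a ]≔ inside) (begin
  ((B [ b ]≔ outside) [ c ]≔ inside) [ c ]≔ outside ≡⟨ []≔-idempotent _ c ⟩
  (B [ b ]≔ outside) [ c ]≔ outside                 ≡⟨ []≔-id-local _ c c-outside ⟩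
  B [ b ]≔ outside                                  ∎)
  where
  open ≡-Reasoning
  c-outside : lookup (B [ b ]≔ outside) c ≡ outside
  c-outside = trans (lookup∘update′ (≢-sym b≢c) B outside) (∉⇒lookup≡outside c∉B)

-- The first shift empties `c` and the second refills it. Updates at distinct positions commute, so
-- the two writes at `c` can be brought together, where they merge into rewriting the value already
-- there.
shift-via-∈ : ∀ {a b c} (B : Subset n) → a ≢ b → a ≢ c → b ≢ c → c ∈ B →
              shift c b (shift a c B) ≡ shift a b B
shift-via-∈ {a = a} {b} {c} B a≢b a≢c b≢c c∈B = begin
  (((B [ c ]≔ outside) [ a ]≔ inside) [ b ]≔ outside) [ c ]≔ inside
    ≡⟨ cong (_[ c ]≔ inside) ([]≔-commutes _ a b a≢b) ⟩
  (((B [ c ]≔ outside) [ b ]≔ outside) [ a ]≔ inside) [ c ]≔ inside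
    ≡⟨ []≔-commutes _ a c a≢c ⟩
  (((B [ c ]≔ outside) [ b ]≔ outside) [ c ]≔ inside) [ a ]≔ inside
    ≡⟨ cong (_[ a ]≔ inside) ([]≔-commutes _ b c b≢c) ⟩
  (((B [ c ]≔ outside) [ c ]≔ inside) [ b ]≔ outside) [ a ]≔ inside
    ≡⟨ cong (shift a b) ([]≔-idempotent B c) ⟩
  shift a b (B [ c ]≔ inside)
    ≡⟨ cong (shift a b) ([]≔-id-local B c ([]=⇒lookup c∈B)) ⟩
  shift a b B ∎
  where open ≡-Reasoning

lookup-shift-target : ∀ a b (B : Subset n) → lookup (shift a b B) a ≡ inside
lookup-shift-target a b B = lookup∘update a (B [ b ]≔ outside) inside

lookup-shift-source : ∀ {a b} (B : Subset n) → a ≢ b → lookup (shift a b B) b ≡ outside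
lookup-shift-source {b = b} B a≢b =
  trans (lookup∘update′ (≢-sym a≢b) (B [ b ]≔ outside) inside) (lookup∘update b B outside)

lookup-shift-other : ∀ {a b x} (B : Subset n) → x ≢ a → x ≢ b →
                     lookup (shift a b B) x ≡ lookup B x
lookup-shift-other {b = b} B x≢a x≢b =
  trans (lookup∘update′ x≢a (B [ b ]≔ outside) inside) (lookup∘update′ x≢b B outside)

ClosedUnderShift : Pred (Subset n) ℓ → Fin n → Fin n → Set ℓ
ClosedUnderShift 𝓑 a b = ∀ B → 𝓑 B → a ∉ B → b ∈ B → 𝓑 (shift a b B)

closed-trans : ∀ {𝓑 : Pred (Subset n) ℓ} {a b c} → a < c → c < b →
               ClosedUnderShift 𝓑 a c → ClosedUnderShift 𝓑 c b → ClosedUnderShift 𝓑 a b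
closed-trans {𝓑 = 𝓑} {a} {b} {c} a<c c<b closed-ac closed-cb B B∈𝓑 a∉B b∈B = via (c ∈? B)
  where
  a≢c : a ≢ c
  a≢c = <⇒≢ a<c
  c≢b : c ≢ b
  c≢b = <⇒≢ c<b
  a≢b : a ≢ b
  a≢b = <⇒≢ (ℕ.<-trans a<c c<b)
  via : Dec (c ∈ B) → 𝓑 (shift a b B)
  -- Each shift needs its target absent and its source present; this dictates which of the two goes
  -- first.
  via (no c∉B) = subst 𝓑 (shift-via-∉ B (≢-sym c≢b) c∉B)
    (closed-ac (shift c b B) (closed-cb B B∈𝓑 c∉B b∈B)
      (lookup≡outside⇒∉ (trans (lookup-shift-other B a≢c a≢b) (∉⇒lookup≡outside a∉B)))
      (lookup⇒[]= c _ (lookup-shift-target c b B)))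
  via (yes c∈B) = subst 𝓑 (shift-via-∈ B a≢b a≢c (≢-sym c≢b) c∈B)
    (closed-cb (shift a c B) (closed-ac B B∈𝓑 a∉B c∈B)
      (lookup≡outside⇒∉ (lookup-shift-source B a≢c))
      (lookup⇒[]= b _ (trans (lookup-shift-other B (≢-sym a≢b) (≢-sym c≢b)) ([]=⇒lookup b∈B))))

module _ {𝓑 : Pred (Subset n) ℓ}
         (closed-adjacent : ∀ a b → toℕ b ≡ suc (toℕ a) → ClosedUnderShift 𝓑 a b) where

  -- Induction on the number `d` of values strictly between `a` and `b`, splitting off the lowest
  -- unit step, from `a` to its successor `a⁺`.
  closed-at-distance : ∀ d a b → toℕ b ≡ suc d + toℕ a → ClosedUnderShift 𝓑 a b
  closed-at-distance zero    a b b≡1+a   = closed-adjacent a b b≡1+a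
  closed-at-distance (suc d) a b b≡2+d+a =
    closed-trans
      (adjacent⇒< a⁺≡1+a)
      (subst (ℕ._< toℕ b) (sym a⁺≡1+a) 1+a<b)
      (closed-adjacent a a⁺ a⁺≡1+a)
      (closed-at-distance d a⁺ b b≡1+d+a⁺)
    where
    1+a<b : suc (toℕ a) ℕ.< toℕ b
    1+a<b = subst (suc (toℕ a) ℕ.<_) (sym b≡2+d+a) (ℕ.s≤s (ℕ.s≤s (ℕ.m≤n+m (toℕ a) d)))
    1+a<n : suc (toℕ a) ℕ.< n
    1+a<n = ℕ.<-trans 1+a<b (toℕ<n b)
    a⁺ : Fin n
    a⁺ = fromℕ< 1+a<n
    a⁺≡1+a : toℕ a⁺ ≡ suc (toℕ a)
    a⁺≡1+a = toℕ-fromℕ< 1+a<n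
    b≡1+d+a⁺ : toℕ b ≡ suc d + toℕ a⁺
    b≡1+d+a⁺ = trans b≡2+d+a
      (trans (sym (ℕ.+-suc (suc d) (toℕ a))) (cong (suc d +_) (sym a⁺≡1+a)))

  closed-adjacent⇒shifted : Shifted 𝓑
  closed-adjacent⇒shifted B B∈𝓑 a b a<b a∉B b∈B =
    subst 𝓑 (sym (p-b∪⁅a⁆≡shift B a b))
      -- The truncated subtraction is exact, since `a < b` unfolds to `suc (toℕ a) ≤ toℕ b`.
      (closed-at-distance (toℕ b ∸ suc (toℕ a)) a b b≡1+d+a B B∈𝓑 a∉B b∈B)
    where
    b≡1+d+a : toℕ b ≡ suc (toℕ b ∸ suc (toℕ a)) + toℕ a
    b≡1+d+a = trans (sym (ℕ.m∸n+n≡m a<b)) (ℕ.+-suc _ (toℕ a))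

-- When `a ∉ B` and `b ∈ B`, moving `b` to `a` only interchanges the values of the characteristic
-- vector at these positions, so the shift is the preimage of `B` under the transposition.
lookup-shift : ∀ {a b} {B : Subset n} → a ∉ B → b ∈ B → ∀ k →
               lookup (shift a b B) k ≡ lookup B (Components.transpose b a k)
lookup-shift {a = a} {b} {B} a∉B b∈B k with k ≟ b
... | yes refl = trans (lookup-shift-source B λ { refl → a∉B b∈B }) (sym (∉⇒lookup≡outside a∉B))
... | no k≢b with k ≟ a
...   | yes refl = trans (lookup-shift-target a b B) (sym ([]=⇒lookup b∈B))
...   | no  k≢a  = lookup-shift-other B k≢a k≢b

-- No value lies strictly between `a` and `b`, so the pair `(a , b)` itself is the only increasing
-- pair whose order the transposition reverses.
transpose-adjacent-mono : ∀ {a b i j : Fin n} → toℕ b ≡ suc (toℕ a) →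
                          ¬ (i ≡ a × j ≡ b) → i < j →
                          Components.transpose a b i < Components.transpose a b j
transpose-adjacent-mono {a = a} {b} {i} {j} b≡1+a ¬a,b i<j
  with i ≟ a | j ≟ a
... | yes refl | yes refl = contradiction i<j (ℕ.<-irrefl refl)
... | yes refl | no _ with j ≟ b
...   | yes refl = contradiction (refl , refl) ¬a,b
-- Here `i = a` moves up to `b`: `a < j` means `b ≤ j`, and `j ≢ b` makes it strict.
...   | no j≢b   = ≤∧≢⇒< (subst (ℕ._≤ toℕ j) (sym b≡1+a) i<j) (≢-sym j≢b)
transpose-adjacent-mono {a = a} {b} {i} {j} b≡1+a ¬a,b i<j | no _ | yes refl with i ≟ b
...   | yes refl = ℕ.<-trans (adjacent⇒< b≡1+a) (ℕ.<-trans i<j (adjacent⇒< b≡1+a))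
...   | no _     = ℕ.<-trans i<j (adjacent⇒< b≡1+a)
transpose-adjacent-mono {a = a} {b} {i} {j} b≡1+a ¬a,b i<j | no i≢a | no _ with i ≟ b | j ≟ b
...   | yes refl | yes refl = contradiction i<j (ℕ.<-irrefl refl)
...   | yes refl | no _     = ℕ.<-trans (adjacent⇒< b≡1+a) i<j
-- Here `j = b` moves down to `a`: `i < b` means `i ≤ a`, and `i ≢ a` makes it strict.
...   | no _     | yes refl = ≤∧≢⇒< (ℕ.s≤s⁻¹ (subst (toℕ i ℕ.<_) b≡1+a i<j)) i≢a
...   | no _     | no _     = i<j

module _ (P : Poset c ℓ₁ ℓ₂) (f : LinearExtension P n) where

  open PosetProperties P using () renaming (_<_ to _<ₚ_)
  open LinearExtension f using (to; bijection; monotone)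

  -- The hypothesis excludes only one direction of comparability between the elements at `a` and
  -- `b`; `monotone` already excludes the other.
  swapAdjacent : ∀ {a b} → toℕ b ≡ suc (toℕ a) →
                 (∀ {x y} → x <ₚ y → ¬ (to x ≡ a × to y ≡ b)) → LinearExtension P n
  swapAdjacent {a} {b} b≡1+a incomparable = record
    { bijection = Composition.bijection bijection (↔⇒⤖ (transpose a b))
    ; monotone  = λ x<y → transpose-adjacent-mono b≡1+a (incomparable x<y) (monotone x<y)
    }

ISets-closed-adjacent : ∀ (P : Poset c ℓ₁ ℓ₂) {I : Pred (Poset.Carrier P) ℓ} → IsOrderIdeal P I →
                        ∀ a b → toℕ b ≡ suc (toℕ a) → ClosedUnderShift (ISets P n I) a b
ISets-closed-adjacent {n = n} P {I} I-ideal a b b≡1+a B (f , B-of-f) a∉B b∈B =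
  swapAdjacent P f b≡1+a incomparable , λ k → mk⇔ (forth k) (back k)
  where
  open IsOrderIdeal I-ideal
  open PosetProperties P using () renaming (_<_ to _<ₚ_)
  open LinearExtension f using (to; bijection)
  open Bijection bijection using (injective)
  τ τ⁻¹ : Fin n → Fin n
  τ = Components.transpose a b
  τ⁻¹ = Components.transpose b a

  incomparable : ∀ {x y} → x <ₚ y → ¬ (to x ≡ a × to y ≡ b)
  -- The element `z` of `I` found at `b` is only `≈` to `y`, so `respects-≈` is what carries
  -- membership over to `y`. Then `x ∈ I` by down-closure, which would put `a` in `B`.
  incomparable {x} {y} x<y (x↦a , y↦b) with z , z∈I , z↦b ← Equivalence.to (B-of-f b) b∈B =
    a∉B (Equivalence.from (B-of-f a) (x , downClosed x<y y∈I , x↦a))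
    where
    y∈I : I y
    y∈I = respects-≈ (injective (trans z↦b (sym y↦b))) z∈I

  forth : ∀ k → k ∈ shift a b B → ∃ λ x → I x × τ (to x) ≡ k
  -- Membership of `k` in the shifted set is membership of `τ⁻¹ k` in `B`; the element of `I` that
  -- `f` sends there is sent to `k` after the swap.
  forth k k∈B′ with x , x∈I , x↦τ⁻¹k ← Equivalence.to (B-of-f (τ⁻¹ k))
    (lookup⇒[]= (τ⁻¹ k) B (trans (sym (lookup-shift a∉B b∈B k)) ([]=⇒lookup k∈B′))) =
    x , x∈I , trans (cong τ x↦τ⁻¹k) (Components.transpose-inverse a b)

  back : ∀ k → (∃ λ x → I x × τ (to x) ≡ k) → k ∈ shift a b B
  back k (x , x∈I , refl) = lookup⇒[]= k _ (begin
    lookup (shift a b B) (τ (to x)) ≡⟨ lookup-shift a∉B b∈B _ ⟩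
    lookup B (τ⁻¹ (τ (to x)))       ≡⟨ cong (lookup B) (Components.transpose-inverse b a) ⟩
    lookup B (to x)                 ≡⟨ []=⇒lookup (Equivalence.from (B-of-f _) (x , x∈I , refl)) ⟩
    inside                          ∎)
    where open ≡-Reasoning

proposition4p6 : ∀ {c ℓ₁ ℓ₂ ℓ : Level} (P : Poset c ℓ₁ ℓ₂) (n : ℕ) → HasSize P n → (I : Pred (Poset.Carrier P) ℓ) → IsOrderIdeal P I → Shifted (ISets P n I)
proposition4p6 P n _ I I-ideal = closed-adjacent⇒shifted (ISets-closed-adjacent P I-ideal)
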